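{- Let $M$ be a proper set system over a finite ground set $V$. Then $M$ is a matroid described by its independent sets if and only if both (1) for each $Y\in M$ and $Y'\subseteq Y$, we have $Y'\in M$, and (2) for each $X\subseteq V$, $\min(M*X)$ is equicardinal.
   Context: A set system is a pair $M=(V,D)$ with $V$ a finite set (the ground set) and $D$ a family of subsets of $V$; it is proper if $D\neq\varnothing$. We write $Y\in M$ for $Y\in D$. $\triangle$ denotes symmetric difference. For $X\subseteq V$, the pivot (twist) of $M$ on $X$ is $M*X=(V,\{Y\triangle X \mid Y\in D\})$. $\min(M)$ is the set system on $V$ whose sets are the members of $D$ that are minimal with respect to inclusion. A set system is equicardinal if all its sets have the same cardinality. "$M=(V,D)$ is a matroid described by its independent sets" means that $D$ is the family of independent sets of a matroid on $V$. -}

module Defs where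

open import Data.Bool.Base using (_xor_)
import Data.Bool.Properties as Bool
open import Data.Fin.Subset using (Subset; ⊥; ⁅_⁆; ∣_∣; _∪_; _∈_; _∉_; _⊆_; _⊂_; _⊄_)
open import Data.Fin.Subset.Properties using (anySubset?; _⊂?_)
open import Data.Nat.Base using (ℕ; _<_)
open import Data.Product.Base using (∃-syntax; _×_; _,_)
open import Data.Vec.Base using (zipWith)
open import Data.Vec.Properties using (≡-dec)
open import Level using (0ℓ)
open import Relation.Binary.PropositionalEquality using (_≡_)
open import Relation.Nullary.Decidable using (map′; ¬?; _×-dec_)
open import Relation.Unary using (Pred; Decidable)

infixl 6 _△_ _*_
infix  4 _∈ˢ_

_△_ : ∀ {n} → Subset n → Subset n → Subset n
_△_ = zipWith _xor_

-- The ground set is Fin n, i.e. an arbitrary finite set up to relabelling.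
-- A family of subsets of a finite set is classically a finite set itself, so
-- membership in it is required to be decidable.
record SetSystem (n : ℕ) : Set₁ where
  field
    family  : Pred (Subset n) 0ℓ
    family? : Decidable family

_∈ˢ_ : ∀ {n} → Subset n → SetSystem n → Set
Y ∈ˢ M = SetSystem.family M Y

Proper : ∀ {n} → SetSystem n → Set
Proper M = ∃[ Y ] Y ∈ˢ M

_*_ : ∀ {n} → SetSystem n → Subset n → SetSystem n
M * X = record
  { family  = λ Z → ∃[ Y ] (Y ∈ˢ M × Z ≡ Y △ X)
  ; family? = λ Z → anySubset? λ Y →
      SetSystem.family? M Y ×-dec ≡-dec Bool._≟_ Z (Y △ X)
  }

min : ∀ {n} → SetSystem n → SetSystem n
min M = record
  { family  = λ Y → Y ∈ˢ M × (∀ Z → Z ∈ˢ M → Z ⊄ Y)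
  ; family? = λ Y → SetSystem.family? M Y ×-dec
      map′ (λ ¬∃ Z Z∈M Z⊂Y → ¬∃ (Z , Z∈M , Z⊂Y))
           (λ { ∀Z (Z , Z∈M , Z⊂Y) → ∀Z Z Z∈M Z⊂Y })
           (¬? (anySubset? λ Z → SetSystem.family? M Z ×-dec (Z ⊂? Y)))
  }

Equicardinal : ∀ {n} → SetSystem n → Set
Equicardinal M = ∀ Y Z → Y ∈ˢ M → Z ∈ˢ M → ∣ Y ∣ ≡ ∣ Z ∣

-- M is the family of independent sets of a matroid: the usual
-- independence axioms.
record IsMatroid {n : ℕ} (M : SetSystem n) : Set where
  field
    empty        : ⊥ ∈ˢ M
    hereditary   : ∀ I J → J ∈ˢ M → I ⊆ J → I ∈ˢ M
    augmentation : ∀ I J → I ∈ˢ M → J ∈ˢ M → ∣ I ∣ < ∣ J ∣ →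
                   ∃[ x ] (x ∈ J × x ∉ I × (I ∪ ⁅ x ⁆) ∈ˢ M)

{-# OPTIONS --safe #-}

-- For a hereditary family M, the minimal members of M * X are exactly the
-- complements X ∖ Y of the maximal members Y of M contained in X, so
-- equicardinality of min (M * X) says that all maximal members of M inside X
-- have the same size.  Augmentation gives this at once; conversely, to augment
-- I from J, apply it to X = I ∪ J: if I could not be augmented, it would be
-- maximal in X, yet J extends to a strictly larger maximal member.
module Submission where

open import Defs
open import Data.Fin.Base using (Fin)
open import Data.Fin.Properties using (any?)
open import Data.Fin.Subset
  using (Subset; inside; outside; ⊥; ⁅_⁆; ∣_∣; _∩_; _∪_; _∈_; _∉_; _⊆_; _⊂_)
open import Data.Fin.Subset.Induction using (⊂-wellFounded)
open import Data.Fin.Subset.Properties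
  using (_∈?_; _⊂?_; anySubset?; drop-there; drop-∷-⊆; ⊆-min; ⊆-refl; ⊆-trans;
         p⊂q⇒p⊆q; p⊆q⇒∣p∣≤∣q∣; p⊆p∪q; q⊆p∪q; p∩q⊆p; p∩q⊆q; x∈p∩q⁺;
         x∈p∪q⁻; x∈⁅x⁆; x∈⁅y⁆⇒x≡y)
open import Data.Nat.Base using (ℕ; suc; _+_; _<_)
open import Data.Nat.Properties
  using (+-suc; +-cancelˡ-≡; +-cancelˡ-<; +-monoˡ-<; ≤-antisym; ≮⇒≥; <-irrefl;
         module ≤-Reasoning)
open import Data.Product.Base as Product using (∃-syntax; _×_; _,_)
open import Data.Sum.Base as Sum using (_⊎_; inj₁; inj₂; [_,_]′)
open import Data.Vec.Base using ([]; _∷_; here; there)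
open import Function.Base using (_∘_; case_of_; id)
open import Function.Bundles using (_⇔_; mk⇔)
open import Induction.WellFounded using (Acc; acc)
open import Relation.Binary.PropositionalEquality
  using (_≡_; refl; sym; trans; cong; subst; module ≡-Reasoning)
open import Relation.Nullary using (¬_; yes; no; contradiction)
open import Relation.Nullary.Decidable using (¬?; _×-dec_; decidable-stable)

private
  variable
    n : ℕ
    x : Fin n
    p q : Subset n

x∈p△q⁺ : (x ∈ p × x ∉ q) ⊎ (x ∉ p × x ∈ q) → x ∈ p △ q
x∈p△q⁺ {q = inside  ∷ _} (inj₁ (here , x∉q))     = contradiction here x∉q
x∈p△q⁺ {q = outside ∷ _} (inj₁ (here , _))       = here
x∈p△q⁺ {q = _ ∷ _}       (inj₁ (there x∈p , x∉q)) = there (x∈p△q⁺ (inj₁ (x∈p , x∉q ∘ there)))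
x∈p△q⁺ {p = inside  ∷ _} (inj₂ (x∉p , here))     = contradiction here x∉p
x∈p△q⁺ {p = outside ∷ _} (inj₂ (_ , here))       = here
x∈p△q⁺ {p = _ ∷ _}       (inj₂ (x∉p , there x∈q)) = there (x∈p△q⁺ (inj₂ (x∉p ∘ there , x∈q)))

x∈p△q⁻ : ∀ (p q : Subset n) → x ∈ p △ q → (x ∈ p × x ∉ q) ⊎ (x ∉ p × x ∈ q)
x∈p△q⁻ (inside  ∷ _) (outside ∷ _) here       = inj₁ (here , λ ())
x∈p△q⁻ (outside ∷ _) (inside  ∷ _) here       = inj₂ ((λ ()) , here)
x∈p△q⁻ (_ ∷ p)       (_ ∷ q)       (there x∈) =
  Sum.map (Product.map there (_∘ drop-there)) (Product.map (_∘ drop-there) there) (x∈p△q⁻ p q x∈)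

-- For `p ⊆ q`, `p △ q` is the complement of `p` in `q`. This converts sizes of twisted sets into
-- sizes of the original ones.
p⊆q⇒∣p∣+∣p△q∣≡∣q∣ : ∀ (p q : Subset n) → p ⊆ q → ∣ p ∣ + ∣ p △ q ∣ ≡ ∣ q ∣
p⊆q⇒∣p∣+∣p△q∣≡∣q∣ []            []            _   = refl
p⊆q⇒∣p∣+∣p△q∣≡∣q∣ (inside  ∷ p) (outside ∷ q) p⊆q = case p⊆q here of λ ()
p⊆q⇒∣p∣+∣p△q∣≡∣q∣ (inside  ∷ p) (inside  ∷ q) p⊆q =
  cong suc (p⊆q⇒∣p∣+∣p△q∣≡∣q∣ p q (drop-∷-⊆ p⊆q))
p⊆q⇒∣p∣+∣p△q∣≡∣q∣ (outside ∷ p) (outside ∷ q) p⊆q =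
  p⊆q⇒∣p∣+∣p△q∣≡∣q∣ p q (drop-∷-⊆ p⊆q)
p⊆q⇒∣p∣+∣p△q∣≡∣q∣ (outside ∷ p) (inside  ∷ q) p⊆q =
  trans (+-suc ∣ p ∣ _) (cong suc (p⊆q⇒∣p∣+∣p△q∣≡∣q∣ p q (drop-∷-⊆ p⊆q)))

p∪⁅x⁆⊆q : p ⊆ q → x ∈ q → p ∪ ⁅ x ⁆ ⊆ q
p∪⁅x⁆⊆q {p = p} {q = q} {x = x} p⊆q x∈q y∈ with x∈p∪q⁻ p ⁅ x ⁆ y∈
... | inj₁ y∈p = p⊆q y∈p
... | inj₂ y∈x = subst (_∈ q) (sym (x∈⁅y⁆⇒x≡y x y∈x)) x∈q

-- Cutting `Y` down to `X` drops the part `Y ∖ X` of `Y △ X`, which contains `x`, and keeps the part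
-- `X ∖ Y`.
∩-△-⊂ : ∀ (Y X : Subset n) → x ∈ Y → x ∉ X → (Y ∩ X) △ X ⊂ Y △ X
∩-△-⊂ {x = x} Y X x∈Y x∉X = sub , x , x∈p△q⁺ (inj₁ (x∈Y , x∉X)) , notIn
  where
  sub : (Y ∩ X) △ X ⊆ Y △ X
  sub y∈ with x∈p△q⁻ (Y ∩ X) X y∈
  ... | inj₁ (y∈∩ , y∉X) = contradiction (p∩q⊆q Y X y∈∩) y∉X
  ... | inj₂ (y∉∩ , y∈X) = x∈p△q⁺ (inj₂ ((λ y∈Y → y∉∩ (x∈p∩q⁺ (y∈Y , y∈X))) , y∈X))

  notIn : x ∉ (Y ∩ X) △ X
  notIn x∈ with x∈p△q⁻ (Y ∩ X) X x∈
  ... | inj₁ (x∈∩ , _) = x∉X (p∩q⊆q Y X x∈∩)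
  ... | inj₂ (_ , x∈X) = x∉X x∈X

-- Below `r`, twisting by `r` is complementation in `r`, which reverses strict inclusion.
△-antimono-⊂ : ∀ (p q r : Subset n) → p ⊂ q → q ⊆ r → q △ r ⊂ p △ r
△-antimono-⊂ p q r (p⊆q , x , x∈q , x∉p) q⊆r =
  sub , x , x∈p△q⁺ (inj₂ (x∉p , q⊆r x∈q)) , notIn
  where
  sub : q △ r ⊆ p △ r
  sub y∈ with x∈p△q⁻ q r y∈
  ... | inj₁ (y∈q , y∉r) = contradiction (q⊆r y∈q) y∉r
  ... | inj₂ (y∉q , y∈r) = x∈p△q⁺ (inj₂ (y∉q ∘ p⊆q , y∈r))

  notIn : x ∉ q △ r
  notIn x∈ with x∈p△q⁻ q r x∈
  ... | inj₁ (_ , x∉r) = x∉r (q⊆r x∈q)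
  ... | inj₂ (x∉q , _) = x∉q x∈q

-- An element of `p` outside `q` would lie in `r`, hence in `q △ r` but not in `p △ r`. Here `q` may
-- stick out of `r`, as an arbitrary member of `M` can.
△-reflects-⊇ : ∀ (p q r : Subset n) → p ⊆ r → q △ r ⊆ p △ r → p ⊆ q
△-reflects-⊇ p q r p⊆r q△r⊆p△r {y} y∈p with y ∈? q
... | yes y∈q = y∈q
... | no  y∉q with x∈p△q⁻ p r (q△r⊆p△r (x∈p△q⁺ (inj₂ (y∉q , p⊆r y∈p))))
...   | inj₁ (_ , y∉r) = contradiction (p⊆r y∈p) y∉r
...   | inj₂ (y∉p , _) = contradiction y∈p y∉p

∣△∣-antimono-< : ∀ (p q r : Subset n) → p ⊆ r → q ⊆ r → ∣ p ∣ < ∣ q ∣ → ∣ q △ r ∣ < ∣ p △ r ∣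
∣△∣-antimono-< p q r p⊆r q⊆r ∣p∣<∣q∣ = +-cancelˡ-< ∣ p ∣ _ _ (begin-strict
  ∣ p ∣ + ∣ q △ r ∣  <⟨ +-monoˡ-< ∣ q △ r ∣ ∣p∣<∣q∣ ⟩
  ∣ q ∣ + ∣ q △ r ∣  ≡⟨ p⊆q⇒∣p∣+∣p△q∣≡∣q∣ q r q⊆r ⟩
  ∣ r ∣              ≡⟨ p⊆q⇒∣p∣+∣p△q∣≡∣q∣ p r p⊆r ⟨
  ∣ p ∣ + ∣ p △ r ∣  ∎)
  where open ≤-Reasoning

Hereditary : SetSystem n → Set
Hereditary {n} M = ∀ (Y Y′ : Subset n) → Y ∈ˢ M → Y′ ⊆ Y → Y′ ∈ˢ M

-- Descent along strict inclusion, which is well-founded on subsets of a finite set; decidability of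
-- the family tells at each stage whether a smaller member remains.
∃-min⊆ : ∀ (M : SetSystem n) (Y : Subset n) → Y ∈ˢ M → ∃[ Z ] (Z ∈ˢ min M × Z ⊆ Y)
∃-min⊆ {n} M Y = go Y (⊂-wellFounded Y)
  where
  go : ∀ (Y : Subset n) → Acc _⊂_ Y → Y ∈ˢ M → ∃[ Z ] (Z ∈ˢ min M × Z ⊆ Y)
  go Y (acc rec) Y∈M with anySubset? (λ Z → SetSystem.family? M Z ×-dec (Z ⊂? Y))
  ... | no  ∄Z = Y , (Y∈M , λ Z Z∈M Z⊂Y → ∄Z (Z , Z∈M , Z⊂Y)) , ⊆-refl
  ... | yes (Z , Z∈M , Z⊂Y) with go Z (rec Z⊂Y) Z∈M
  ...   | W , W∈min , W⊆Z = W , W∈min , ⊆-trans W⊆Z (p⊂q⇒p⊆q Z⊂Y)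

-- Otherwise `Y ∩ X`, a member by heredity, would have a strictly smaller twist.
min-*⇒⊆ : ∀ (M : SetSystem n) (X Y : Subset n) → Hereditary M →
          Y ∈ˢ M → Y △ X ∈ˢ min (M * X) → Y ⊆ X
min-*⇒⊆ M X Y hered Y∈M (_ , minimal) {x} x∈Y with x ∈? X
... | yes x∈X = x∈X
... | no  x∉X = contradiction (∩-△-⊂ Y X x∈Y x∉X)
  (minimal _ (Y ∩ X , hered Y (Y ∩ X) Y∈M (p∩q⊆p Y X) , refl))

-- Augmenting `Y` by an element of `Z` stays inside `X`, so its twist would fall strictly below the
-- minimal `Y △ X`.
augmentation⇒min-*-≮ :
  ∀ (M : SetSystem n) (X Y Z : Subset n) → IsMatroid M →
  Y ∈ˢ M → Y △ X ∈ˢ min (M * X) → Z ∈ˢ M → Z ⊆ X → Y ⊆ X → ¬ ∣ Y ∣ < ∣ Z ∣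
augmentation⇒min-*-≮ M X Y Z matroid Y∈M (_ , minimal) Z∈M Z⊆X Y⊆X ∣Y∣<∣Z∣
  with IsMatroid.augmentation matroid Y Z Y∈M Z∈M ∣Y∣<∣Z∣
... | x , x∈Z , x∉Y , Y∪x∈M = minimal _ (Y ∪ ⁅ x ⁆ , Y∪x∈M , refl)
  (△-antimono-⊂ Y (Y ∪ ⁅ x ⁆) X
    (p⊆p∪q ⁅ x ⁆ , x , q⊆p∪q Y ⁅ x ⁆ (x∈⁅x⁆ x) , x∉Y)
    (p∪⁅x⁆⊆q Y⊆X (Z⊆X x∈Z)))

matroid⇒equicardinal : ∀ (M : SetSystem n) → IsMatroid M →
                       ∀ X → Equicardinal (min (M * X))
matroid⇒equicardinal M matroid X _ _
  Y△X∈min@((Y , Y∈M , refl) , _) Z△X∈min@((Z , Z∈M , refl) , _) =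
  +-cancelˡ-≡ ∣ Y ∣ _ _ (begin
    ∣ Y ∣ + ∣ Y △ X ∣  ≡⟨ p⊆q⇒∣p∣+∣p△q∣≡∣q∣ Y X Y⊆X ⟩
    ∣ X ∣              ≡⟨ p⊆q⇒∣p∣+∣p△q∣≡∣q∣ Z X Z⊆X ⟨
    ∣ Z ∣ + ∣ Z △ X ∣  ≡⟨ cong (_+ ∣ Z △ X ∣) ∣Y∣≡∣Z∣ ⟨
    ∣ Y ∣ + ∣ Z △ X ∣  ∎)
  where
  open ≡-Reasoning

  hered : Hereditary M
  hered Y Y′ = IsMatroid.hereditary matroid Y′ Y

  Y⊆X : Y ⊆ X
  Y⊆X = min-*⇒⊆ M X Y hered Y∈M Y△X∈min

  Z⊆X : Z ⊆ X
  Z⊆X = min-*⇒⊆ M X Z hered Z∈M Z△X∈min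

  ∣Y∣≡∣Z∣ : ∣ Y ∣ ≡ ∣ Z ∣
  ∣Y∣≡∣Z∣ = ≤-antisym
    (≮⇒≥ (augmentation⇒min-*-≮ M X Z Y matroid Z∈M Z△X∈min Y∈M Y⊆X Z⊆X))
    (≮⇒≥ (augmentation⇒min-*-≮ M X Y Z matroid Y∈M Y△X∈min Z∈M Z⊆X Y⊆X))

equicardinal⇒augmentation :
  ∀ (M : SetSystem n) → Hereditary M → (∀ X → Equicardinal (min (M * X))) →
  ∀ I J → I ∈ˢ M → J ∈ˢ M → ∣ I ∣ < ∣ J ∣ →
  ∃[ x ] (x ∈ J × x ∉ I × (I ∪ ⁅ x ⁆) ∈ˢ M)
equicardinal⇒augmentation {n} M hered equi I J I∈M J∈M ∣I∣<∣J∣ =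
  -- The search for `x` runs over a finite set with decidable conditions, so arguing by
  -- contradiction is constructive here.
  decidable-stable
    (any? λ x → (x ∈? J) ×-dec ¬? (x ∈? I) ×-dec SetSystem.family? M (I ∪ ⁅ x ⁆))
    impossible
  where
  X : Subset n
  X = I ∪ J

  -- A twist of `Y` strictly below `I △ X` forces `I ⊆ Y` and yields some `x` of `Y` in `X` outside
  -- `I`. Such an `x` comes from `J`, and heredity puts `I ∪ ⁅ x ⁆` in `M`, contrary to assumption.
  I△X-minimal : ¬ (∃[ x ] (x ∈ J × x ∉ I × (I ∪ ⁅ x ⁆) ∈ˢ M)) →
                ∀ Z → Z ∈ˢ (M * X) → ¬ Z ⊂ I △ X
  I△X-minimal ∄x _ (Y , Y∈M , refl) (Y△X⊆I△X , x , x∈I△X , x∉Y△X)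
    with x∈p△q⁻ I X x∈I△X
  ... | inj₁ (x∈I , x∉X) = x∉X (p⊆p∪q J x∈I)
  ... | inj₂ (x∉I , x∈X) = ∄x (x , x∈J , x∉I , hered Y (I ∪ ⁅ x ⁆) Y∈M (p∪⁅x⁆⊆q I⊆Y x∈Y))
    where
    I⊆Y : I ⊆ Y
    I⊆Y = △-reflects-⊇ I Y X (p⊆p∪q J) Y△X⊆I△X

    x∈Y : x ∈ Y
    x∈Y = decidable-stable (x ∈? Y) λ x∉Y → x∉Y△X (x∈p△q⁺ (inj₂ (x∉Y , x∈X)))

    x∈J : x ∈ J
    x∈J = [ (λ x∈I → contradiction x∈I x∉I) , id ]′ (x∈p∪q⁻ I J x∈X)

  impossible : ¬ ¬ (∃[ x ] (x ∈ J × x ∉ I × (I ∪ ⁅ x ⁆) ∈ˢ M))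
  -- `Z` is the complement in `X` of a maximal member extending `J`, so it is strictly smaller than
  -- `I △ X`; yet both are minimal and hence of equal size.
  impossible ∄x with ∃-min⊆ (M * X) (J △ X) (J , J∈M , refl)
  ... | Z , Z∈min , Z⊆J△X = <-irrefl refl (begin-strict
    ∣ Z ∣      ≤⟨ p⊆q⇒∣p∣≤∣q∣ Z⊆J△X ⟩
    ∣ J △ X ∣  <⟨ ∣△∣-antimono-< I J X (p⊆p∪q J) (q⊆p∪q I J) ∣I∣<∣J∣ ⟩
    ∣ I △ X ∣  ≡⟨ equi X (I △ X) Z ((I , I∈M , refl) , I△X-minimal ∄x) Z∈min ⟩
    ∣ Z ∣      ∎)
    where open ≤-Reasoning

corollary4p5 : ∀ (n : ℕ) (M : SetSystem n) → Proper M →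
    IsMatroid M ⇔
    ((∀ (Y Y′ : Subset n) → Y ∈ˢ M → Y′ ⊆ Y → Y′ ∈ˢ M) ×
    (∀ (X : Subset n) → Equicardinal (min (M * X))))
corollary4p5 n M (Y , Y∈M) = mk⇔
  (λ matroid → (λ Y Y′ → IsMatroid.hereditary matroid Y′ Y) , matroid⇒equicardinal M matroid)
  (λ (hered , equi) → record
    -- Properness supplies the member `Y` from which heredity descends to `⊥`.
    { empty        = hered Y ⊥ Y∈M (⊆-min Y)
    ; hereditary   = λ I J → hered J I
    ; augmentation = equicardinal⇒augmentation M hered equi
    })
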